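{- Let $\beta>1$ be a real number. If $T_{ -\beta}^k(\ell_\beta) = 0$ for some integer $k \ge 1$, or if $\beta$ is the root of a polynomial $p(x) \in \mathbb{Z}[x]$ with $|p(-1)|=1$, then $\beta$ does not possess Property ($-$F).
   Context: For a real number $\beta>1$, set $\ell_\beta = \frac{ -\beta}{\beta+1}$ and define the $(-\beta)$-transformation $T_{ -\beta}: [\ell_\beta,\ell_\beta+1)\to[\ell_\beta,\ell_\beta+1)$ by $T_{ -\beta}(x) = -\beta x - \lfloor -\beta x-\ell_\beta\rfloor$. For $x\in[\ell_\beta,\ell_\beta+1)$ let $d_{ -\beta}(x)=x_1x_2x_3\cdots$ with $x_i = \lfloor -\beta T_{ -\beta}^{i-1}(x)-\ell_\beta\rfloor\in\{0,1,\dots,\lfloor\beta\rfloor\}$, so that $x=\sum_{i\ge1} x_i(-\beta)^{ -i}$. For $x\in\mathbb{R}$, let $k\ge 0$ be the minimal integer with $\frac{x}{(-\beta)^k}\in(\ell_\beta,\ell_\beta+1)$ and let $d_{ -\beta}(\frac{x}{(-\beta)^k})=x_1x_2x_3\cdots$; the $(-\beta)$-expansion of $x$ is $x_1\cdots x_k\bullet x_{k+1}x_{k+2}\cdots$ if $k\ge1$ and $0\bullet x_1x_2\cdots$ if $k=0$. It is finite if only finitely many digits are nonzero, i.e. if $T_{ -\beta}^n(\frac{x}{(-\beta)^k})=0$ for some $n\ge0$. The number $\beta$ has Property ($-$F) if each element of $\mathbb{Z}[\beta^{ -1}]$ has a finite $(-\beta)$-expansion. -}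

module Defs where

open import Algebra.Bundles.Raw using (RawRing)
open import Data.Empty using (⊥-elim)
open import Data.Integer.Base as ℤ using (ℤ; +_)
open import Data.List.Base using (List; []; _∷_; applyUpTo)
open import Data.Nat.Base as ℕ using (ℕ; zero; suc)
import Data.Nat.Properties as ℕₚ
open import Data.Product.Base using (∃-syntax; _×_; _,_)
open import Data.Rational.Base as ℚ using (ℚ; 0ℚ; 1ℚ; ½; ∣_∣)
import Data.Rational.Properties as ℚₚ
open import Data.Rational.Solver using (module +-*-Solver)
open import Data.Sum.Base using (_⊎_; inj₁; inj₂)
open import Level using (0ℓ)
open import Relation.Binary.PropositionalEquality
  using (_≡_; _≢_; refl; sym; trans; cong; cong₂; subst)
open import Relation.Nullary using (¬_; yes; no)

open +-*-Solver using (solve; _:=_; _:+_; _:*_; :-_; _:-_)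

Eventually : (ℕ → Set) → Set
Eventually P = ∃[ N ] (∀ n → N ℕ.≤ n → P n)

Cauchy : (ℕ → ℚ) → Set
Cauchy s = ∀ ε → 0ℚ ℚ.< ε →
  ∃[ N ] (∀ m n → N ℕ.≤ m → N ℕ.≤ n → ∣ s m ℚ.- s n ∣ ℚ.< ε)

halve : ∀ ε → ε ℚ.* ½ ℚ.+ ε ℚ.* ½ ≡ ε
halve ε = trans (sym (ℚₚ.*-distribˡ-+ ε ½ ½)) (ℚₚ.*-identityʳ ε)

*-pos : ∀ {p q} → 0ℚ ℚ.< p → 0ℚ ℚ.< q → 0ℚ ℚ.< p ℚ.* q
*-pos {p} {q} 0<p 0<q = ℚₚ.positive⁻¹ (p ℚ.* q)
  {{ℚₚ.pos*pos⇒pos p {{ℚ.positive 0<p}} q {{ℚ.positive 0<q}}}}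

half-pos : ∀ {ε} → 0ℚ ℚ.< ε → 0ℚ ℚ.< ε ℚ.* ½
half-pos 0<ε = *-pos 0<ε (ℚₚ.positive⁻¹ ½)

ratio : ∀ {B ε} → 0ℚ ℚ.< B → 0ℚ ℚ.< ε → ∃[ δ ] (0ℚ ℚ.< δ × B ℚ.* δ ≡ ε)
ratio {B} {ε} 0<B 0<ε = B⁻¹ ℚ.* ε , *-pos 0<B⁻¹ 0<ε , eq
  where
  instance
    B-pos = ℚ.positive 0<B
    B-nz  = ℚₚ.pos⇒nonZero B
  B⁻¹ = ℚ.1/ B
  0<B⁻¹ : 0ℚ ℚ.< B⁻¹
  0<B⁻¹ = ℚₚ.positive⁻¹ B⁻¹ {{ℚₚ.1/pos⇒pos B}}
  eq : B ℚ.* (B⁻¹ ℚ.* ε) ≡ ε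
  eq = trans (sym (ℚₚ.*-assoc B B⁻¹ ε))
         (trans (cong (ℚ._* ε) (ℚₚ.*-inverseʳ B)) (ℚₚ.*-identityˡ ε))

∣*∣≤ : ∀ {a b A B} → 0ℚ ℚ.≤ A → ∣ a ∣ ℚ.≤ A → ∣ b ∣ ℚ.≤ B →
       ∣ a ℚ.* b ∣ ℚ.≤ A ℚ.* B
∣*∣≤ {a} {b} {A} {B} 0≤A a≤A b≤B = begin
  ∣ a ℚ.* b ∣        ≡⟨ ℚₚ.∣p*q∣≡∣p∣*∣q∣ a b ⟩
  ∣ a ∣ ℚ.* ∣ b ∣    ≤⟨ ℚₚ.*-monoʳ-≤-nonNeg ∣ b ∣ {{ℚₚ.∣-∣-nonNeg b}} a≤A ⟩
  A ℚ.* ∣ b ∣        ≤⟨ ℚₚ.*-monoˡ-≤-nonNeg A {{ℚ.nonNegative 0≤A}} b≤B ⟩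
  A ℚ.* B            ∎
  where open ℚₚ.≤-Reasoning

∣*∣< : ∀ {a b A B} → 0ℚ ℚ.< A → ∣ a ∣ ℚ.≤ A → ∣ b ∣ ℚ.< B →
       ∣ a ℚ.* b ∣ ℚ.< A ℚ.* B
∣*∣< {a} {b} {A} {B} 0<A a≤A b<B = ℚₚ.≤-<-trans
  (∣*∣≤ {a} {b} (ℚₚ.<⇒≤ 0<A) a≤A ℚₚ.≤-refl)
  (ℚₚ.*-monoʳ-<-pos A {{ℚ.positive 0<A}} b<B)

∣+∣< : ∀ {a b ε} → ∣ a ∣ ℚ.< ε ℚ.* ½ → ∣ b ∣ ℚ.< ε ℚ.* ½ → ∣ a ℚ.+ b ∣ ℚ.< ε
∣+∣< {a} {b} {ε} a< b< = subst (∣ a ℚ.+ b ∣ ℚ.<_) (halve ε)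
  (ℚₚ.≤-<-trans (ℚₚ.∣p+q∣≤∣p∣+∣q∣ a b) (ℚₚ.+-mono-< a< b<))

bounded : ∀ {s} → Cauchy s →
          ∃[ B ] (0ℚ ℚ.< B × Eventually (λ n → ∣ s n ∣ ℚ.≤ B))
bounded {s} c with c 1ℚ (ℚₚ.positive⁻¹ 1ℚ)
... | N , h = 1ℚ ℚ.+ ∣ s N ∣
            , ℚₚ.+-mono-<-≤ (ℚₚ.positive⁻¹ 1ℚ) (ℚₚ.0≤∣p∣ (s N))
            , N , bound
  where
  open ℚₚ.≤-Reasoning
  bound : ∀ n → N ℕ.≤ n → ∣ s n ∣ ℚ.≤ 1ℚ ℚ.+ ∣ s N ∣
  bound n N≤n = begin
    ∣ s n ∣                           ≡⟨ cong ∣_∣ (solve 2 (λ a b → a := (a :- b) :+ b) refl (s n) (s N)) ⟩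
    ∣ (s n ℚ.- s N) ℚ.+ s N ∣         ≤⟨ ℚₚ.∣p+q∣≤∣p∣+∣q∣ (s n ℚ.- s N) (s N) ⟩
    ∣ s n ℚ.- s N ∣ ℚ.+ ∣ s N ∣       ≤⟨ ℚₚ.+-monoˡ-≤ ∣ s N ∣ (ℚₚ.<⇒≤ (h n N N≤n ℕₚ.≤-refl)) ⟩
    1ℚ ℚ.+ ∣ s N ∣                    ∎

const-cauchy : ∀ q → Cauchy (λ _ → q)
const-cauchy q ε 0<ε = 0 , λ _ _ _ _ →
  subst (ℚ._< ε) (cong ∣_∣ (sym (ℚₚ.+-inverseʳ q))) 0<ε

+-cauchy : ∀ {s t} → Cauchy s → Cauchy t → Cauchy (λ n → s n ℚ.+ t n)
+-cauchy {s} {t} cs ct ε 0<ε with cs _ (half-pos 0<ε) | ct _ (half-pos 0<ε)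
... | M , hs | N , ht = M ℕ.⊔ N , λ m n m≥ n≥ →
  subst (λ r → ∣ r ∣ ℚ.< ε)
    (solve 4 (λ a b c d → (a :- c) :+ (b :- d) := (a :+ b) :- (c :+ d)) refl
      (s m) (t m) (s n) (t n))
    (∣+∣< {s m ℚ.- s n} {t m ℚ.- t n}
      (hs m n (ℕₚ.m⊔n≤o⇒m≤o M N m≥) (ℕₚ.m⊔n≤o⇒m≤o M N n≥))
      (ht m n (ℕₚ.m⊔n≤o⇒n≤o M N m≥) (ℕₚ.m⊔n≤o⇒n≤o M N n≥)))

neg-cauchy : ∀ {s} → Cauchy s → Cauchy (λ n → ℚ.- s n)
neg-cauchy {s} cs ε 0<ε with cs ε 0<ε
... | N , h = N , λ m n m≥ n≥ →
  subst (λ r → ∣ r ∣ ℚ.< ε)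
    (solve 2 (λ a b → b :- a := (:- a) :- (:- b)) refl (s m) (s n))
    (h n m n≥ m≥)

*-close : ∀ {a b c d A B δ η ε} → 0ℚ ℚ.< A → 0ℚ ℚ.< B →
          A ℚ.* δ ≡ ε ℚ.* ½ → B ℚ.* η ≡ ε ℚ.* ½ →
          ∣ a ∣ ℚ.≤ A → ∣ d ∣ ℚ.≤ B → ∣ b ℚ.- d ∣ ℚ.< δ → ∣ a ℚ.- c ∣ ℚ.< η →
          ∣ a ℚ.* b ℚ.- c ℚ.* d ∣ ℚ.< ε
*-close {a} {b} {c} {d} {A} {B} {δ} {η} {ε} 0<A 0<B Aδ≡ Bη≡ a≤A d≤B bd< ac< =
  subst (λ r → ∣ r ∣ ℚ.< ε)
    (solve 4 (λ a b c d → a :* (b :- d) :+ d :* (a :- c) := a :* b :- c :* d)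
      refl a b c d)
    (∣+∣< {a ℚ.* (b ℚ.- d)} {d ℚ.* (a ℚ.- c)}
      (subst (∣ a ℚ.* (b ℚ.- d) ∣ ℚ.<_) Aδ≡ (∣*∣< {a} {b ℚ.- d} 0<A a≤A bd<))
      (subst (∣ d ℚ.* (a ℚ.- c) ∣ ℚ.<_) Bη≡ (∣*∣< {d} {a ℚ.- c} 0<B d≤B ac<)))

*-cauchy : ∀ {s t} → Cauchy s → Cauchy t → Cauchy (λ n → s n ℚ.* t n)
*-cauchy {s} {t} cs ct ε 0<ε =
  let (A , 0<A , M₁ , s≤A) = bounded {s} cs
      (B , 0<B , M₂ , t≤B) = bounded {t} ct
      (δ , 0<δ , Aδ≡) = ratio 0<A (half-pos 0<ε)
      (η , 0<η , Bη≡) = ratio 0<B (half-pos 0<ε)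
      (N₁ , ht) = ct δ 0<δ
      (N₂ , hs) = cs η 0<η
  in (M₁ ℕ.⊔ M₂) ℕ.⊔ (N₁ ℕ.⊔ N₂) , λ m n m≥ n≥ →
    let mM = ℕₚ.m⊔n≤o⇒m≤o (M₁ ℕ.⊔ M₂) (N₁ ℕ.⊔ N₂) m≥
        mN = ℕₚ.m⊔n≤o⇒n≤o (M₁ ℕ.⊔ M₂) (N₁ ℕ.⊔ N₂) m≥
        nM = ℕₚ.m⊔n≤o⇒m≤o (M₁ ℕ.⊔ M₂) (N₁ ℕ.⊔ N₂) n≥
        nN = ℕₚ.m⊔n≤o⇒n≤o (M₁ ℕ.⊔ M₂) (N₁ ℕ.⊔ N₂) n≥
    in *-close {s m} {t m} {s n} {t n} 0<A 0<B Aδ≡ Bη≡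
         (s≤A m (ℕₚ.m⊔n≤o⇒m≤o M₁ M₂ mM))
         (t≤B n (ℕₚ.m⊔n≤o⇒n≤o M₁ M₂ nM))
         (ht m n (ℕₚ.m⊔n≤o⇒m≤o N₁ N₂ mN) (ℕₚ.m⊔n≤o⇒m≤o N₁ N₂ nN))
         (hs m n (ℕₚ.m⊔n≤o⇒n≤o N₁ N₂ mN) (ℕₚ.m⊔n≤o⇒n≤o N₁ N₂ nN))

-- The value at 0 is irrelevant: sequences of reals apart from 0 are
-- eventually nonzero.
recip : ℚ → ℚ
recip q with q ℚₚ.≟ 0ℚ
... | yes _  = 0ℚ
... | no q≢0 = ℚ.1/_ q {{ℚ.≢-nonZero q≢0}}

recip-inverseʳ : ∀ {q} → q ≢ 0ℚ → q ℚ.* recip q ≡ 1ℚ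
recip-inverseʳ {q} q≢0 with q ℚₚ.≟ 0ℚ
... | yes q≡0 = ⊥-elim (q≢0 q≡0)
... | no q≢0′ = ℚₚ.*-inverseʳ q {{ℚ.≢-nonZero q≢0′}}

recip-bound : ∀ {a δ B} → 0ℚ ℚ.< δ → δ ℚ.* B ≡ 1ℚ → δ ℚ.≤ ∣ a ∣ →
              a ≢ 0ℚ → ∣ recip a ∣ ℚ.≤ B
recip-bound {a} {δ} {B} 0<δ δB≡1 δ≤a a≢0 =
  ℚₚ.*-cancelˡ-≤-pos δ {{ℚ.positive 0<δ}} (begin
    δ ℚ.* ∣ recip a ∣        ≤⟨ ℚₚ.*-monoʳ-≤-nonNeg ∣ recip a ∣ {{ℚₚ.∣-∣-nonNeg (recip a)}} δ≤a ⟩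
    ∣ a ∣ ℚ.* ∣ recip a ∣    ≡⟨ ℚₚ.∣p*q∣≡∣p∣*∣q∣ a (recip a) ⟨
    ∣ a ℚ.* recip a ∣        ≡⟨ cong ∣_∣ (recip-inverseʳ a≢0) ⟩
    1ℚ                       ≡⟨ δB≡1 ⟨
    δ ℚ.* B                  ∎)
  where open ℚₚ.≤-Reasoning

recip-difference : ∀ {a b a′ b′} → a ℚ.* a′ ≡ 1ℚ → b ℚ.* b′ ≡ 1ℚ →
                   (a′ ℚ.* b′) ℚ.* (b ℚ.- a) ≡ a′ ℚ.- b′
recip-difference {a} {b} {a′} {b′} p q = trans
  (solve 4 (λ a b a′ b′ → (a′ :* b′) :* (b :- a) := (b :* b′) :* a′ :- (a :* a′) :* b′)
    refl a b a′ b′)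
  (trans (cong₂ (λ u v → u ℚ.* a′ ℚ.- v ℚ.* b′) q p)
         (cong₂ ℚ._-_ (ℚₚ.*-identityˡ a′) (ℚₚ.*-identityˡ b′)))

recip-close : ∀ {a b δ B η ε} → 0ℚ ℚ.< δ → 0ℚ ℚ.< B → δ ℚ.* B ≡ 1ℚ →
              (B ℚ.* B) ℚ.* η ≡ ε → δ ℚ.≤ ∣ a ∣ → δ ℚ.≤ ∣ b ∣ →
              ∣ b ℚ.- a ∣ ℚ.< η → ∣ recip a ℚ.- recip b ∣ ℚ.< ε
recip-close {a} {b} {δ} {B} {η} {ε} 0<δ 0<B δB≡1 BBη≡ε δ≤a δ≤b ba< =
  subst (λ r → ∣ r ∣ ℚ.< ε)
    (recip-difference {a} {b} (recip-inverseʳ a≢0) (recip-inverseʳ b≢0))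
    (subst (∣ (recip a ℚ.* recip b) ℚ.* (b ℚ.- a) ∣ ℚ.<_) BBη≡ε
      (∣*∣< {recip a ℚ.* recip b} {b ℚ.- a} (*-pos 0<B 0<B)
        (∣*∣≤ {recip a} {recip b} (ℚₚ.<⇒≤ 0<B)
          (recip-bound 0<δ δB≡1 δ≤a a≢0) (recip-bound 0<δ δB≡1 δ≤b b≢0))
        ba<))
  where
  nonzero : ∀ {c} → δ ℚ.≤ ∣ c ∣ → c ≢ 0ℚ
  nonzero δ≤c refl = ℚₚ.<-irrefl refl (ℚₚ.<-≤-trans 0<δ δ≤c)
  a≢0 = nonzero {a} δ≤a
  b≢0 = nonzero {b} δ≤b

recip-cauchy : ∀ {s} → Cauchy s → ∀ {δ} → 0ℚ ℚ.< δ →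
               Eventually (λ n → δ ℚ.≤ ∣ s n ∣) → Cauchy (λ n → recip (s n))
recip-cauchy {s} cs 0<δ (M , δ≤) ε 0<ε =
  let (B , 0<B , δB≡1) = ratio 0<δ (ℚₚ.positive⁻¹ 1ℚ)
      (η , 0<η , BBη≡ε) = ratio (*-pos 0<B 0<B) 0<ε
      (N , h) = cs η 0<η
  in M ℕ.⊔ N , λ m n m≥ n≥ →
    recip-close {s m} {s n} 0<δ 0<B δB≡1 BBη≡ε
      (δ≤ m (ℕₚ.m⊔n≤o⇒m≤o M N m≥))
      (δ≤ n (ℕₚ.m⊔n≤o⇒m≤o M N n≥))
      (h n m (ℕₚ.m⊔n≤o⇒n≤o M N n≥) (ℕₚ.m⊔n≤o⇒n≤o M N m≥))

-- Elements are Cauchy sequences of rationals; equality of real numbers is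
-- _≃_ below, not _≡_.
record ℝ : Set where
  constructor mkℝ
  field
    seq    : ℕ → ℚ
    cauchy : Cauchy seq

open ℝ public

infix  4 _≃_ _<_ _≤_ _#_
infixl 6 _+_ _-_
infixl 7 _*_
infix  8 -_
infixr 9 _^_

record _≃_ (x y : ℝ) : Set where
  constructor mk≃
  field
    close : ∀ ε → 0ℚ ℚ.< ε → Eventually (λ n → ∣ seq x n ℚ.- seq y n ∣ ℚ.< ε)

record _<_ (x y : ℝ) : Set where
  constructor mk<
  field
    gap     : ℚ
    gap-pos : 0ℚ ℚ.< gap
    apart   : Eventually (λ n → seq x n ℚ.+ gap ℚ.≤ seq y n)

_≤_ : ℝ → ℝ → Set
x ≤ y = ¬ (y < x)

_#_ : ℝ → ℝ → Set
x # y = x < y ⊎ y < x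

fromℚ : ℚ → ℝ
fromℚ q = mkℝ (λ _ → q) (const-cauchy q)

fromℤ : ℤ → ℝ
fromℤ z = fromℚ (z ℚ./ 1)

0ℝ 1ℝ : ℝ
0ℝ = fromℚ 0ℚ
1ℝ = fromℚ 1ℚ

_+_ : ℝ → ℝ → ℝ
x + y = mkℝ (λ n → seq x n ℚ.+ seq y n) (+-cauchy {seq x} {seq y} (cauchy x) (cauchy y))

-_ : ℝ → ℝ
- x = mkℝ (λ n → ℚ.- seq x n) (neg-cauchy {seq x} (cauchy x))

_-_ : ℝ → ℝ → ℝ
x - y = x + (- y)

_*_ : ℝ → ℝ → ℝ
x * y = mkℝ (λ n → seq x n ℚ.* seq y n) (*-cauchy {seq x} {seq y} (cauchy x) (cauchy y))

_^_ : ℝ → ℕ → ℝ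
x ^ zero  = 1ℝ
x ^ suc n = x * x ^ n

away-from-0 : ∀ {x} → x # 0ℝ →
              ∃[ δ ] (0ℚ ℚ.< δ × Eventually (λ n → δ ℚ.≤ ∣ seq x n ∣))
away-from-0 {x} (inj₁ (mk< δ 0<δ (N , h))) = δ , 0<δ , N , λ n N≤n →
  let x+δ≤0 = h n N≤n
      δ≤-x : δ ℚ.≤ ℚ.- seq x n
      δ≤-x = subst (ℚ._≤ ℚ.- seq x n)
        (solve 2 (λ a d → :- a :+ (a :+ d) := d) refl (seq x n) δ)
        (subst (ℚ.- seq x n ℚ.+ (seq x n ℚ.+ δ) ℚ.≤_) (ℚₚ.+-identityʳ _)
          (ℚₚ.+-monoʳ-≤ (ℚ.- seq x n) x+δ≤0))
  in subst (δ ℚ.≤_)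
       (trans (sym (ℚₚ.0≤p⇒∣p∣≡p (ℚₚ.≤-trans (ℚₚ.<⇒≤ 0<δ) δ≤-x)))
              (ℚₚ.∣-p∣≡∣p∣ (seq x n)))
       δ≤-x
away-from-0 {x} (inj₂ (mk< δ 0<δ (N , h))) = δ , 0<δ , N , λ n N≤n →
  let δ≤x = subst (ℚ._≤ seq x n) (ℚₚ.+-identityˡ δ) (h n N≤n)
  in subst (δ ℚ.≤_) (sym (ℚₚ.0≤p⇒∣p∣≡p (ℚₚ.≤-trans (ℚₚ.<⇒≤ 0<δ) δ≤x))) δ≤x

inv : (x : ℝ) → x # 0ℝ → ℝ
inv x x#0 = mkℝ (λ n → recip (seq x n))
  (let (_ , 0<δ , ev) = away-from-0 {x} x#0 in recip-cauchy {seq x} (cauchy x) 0<δ ev)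

ℝ-rawRing : RawRing 0ℓ 0ℓ
ℝ-rawRing = record
  { Carrier = ℝ ; _≈_ = _≃_ ; _+_ = _+_ ; _*_ = _*_ ; -_ = -_ ; 0# = 0ℝ ; 1# = 1ℝ }

-- The integer n is ⌊ x ⌋.
IsFloor : ℝ → ℤ → Set
IsFloor x n = fromℤ n ≤ x × x < fromℤ n + 1ℝ

-- Coefficient lists, constant coefficient first.
ℤ[X] : Set
ℤ[X] = List ℤ

module _ (R : RawRing 0ℓ 0ℓ) (ι : ℤ → RawRing.Carrier R) where
  private module R = RawRing R

  eval : ℤ[X] → R.Carrier → R.Carrier
  eval []      x = R.0#
  eval (a ∷ p) x = ι a R.+ x R.* eval p x

evalℤ : ℤ[X] → ℤ → ℤ
evalℤ = eval ℤ.+-*-rawRing (λ a → a)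

evalℝ : ℤ[X] → ℝ → ℝ
evalℝ = eval ℝ-rawRing fromℤ

record Expansion : Set where
  constructor _•_
  field
    integerPart    : List ℤ
    fractionalPart : ℕ → ℤ

open Expansion public

-- Places the radix point after the first k digits, the integer part
-- being written 0 if k = 0.
pointAfter : ℕ → (ℕ → ℤ) → Expansion
pointAfter zero      d = (+ 0 ∷ []) • d
pointAfter k@(suc _) d = applyUpTo d k • (λ i → d (k ℕ.+ i))

Finite : Expansion → Set
Finite e = Eventually (λ i → fractionalPart e i ≡ + 0)

module NegativeBase (β : ℝ) (1<β : 1ℝ < β) where

  β-pos : 0ℝ < β
  β-pos = let mk< ε 0<ε (N , h) = 1<β in mk< ε 0<ε (N , λ n N≤n →
    ℚₚ.≤-trans (ℚₚ.+-monoˡ-≤ ε (ℚₚ.<⇒≤ (ℚₚ.positive⁻¹ 1ℚ))) (h n N≤n))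

  -β-neg : - β < 0ℝ
  -β-neg = let mk< ε 0<ε (N , h) = β-pos in mk< ε 0<ε (N , λ n N≤n →
    subst (ℚ.- seq β n ℚ.+ ε ℚ.≤_) (ℚₚ.+-inverseˡ (seq β n))
      (ℚₚ.+-monoʳ-≤ (ℚ.- seq β n)
        (subst (ℚ._≤ seq β n) (ℚₚ.+-identityˡ ε) (h n N≤n))))

  β+1-pos : 0ℝ < β + 1ℝ
  β+1-pos = let mk< ε 0<ε (N , h) = β-pos in mk< ε 0<ε (N , λ n N≤n →
    ℚₚ.≤-trans (h n N≤n)
      (subst (ℚ._≤ seq β n ℚ.+ 1ℚ) (ℚₚ.+-identityʳ (seq β n))
        (ℚₚ.+-monoʳ-≤ (seq β n) (ℚₚ.<⇒≤ (ℚₚ.positive⁻¹ 1ℚ)))))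

  β⁻¹ : ℝ
  β⁻¹ = inv β (inj₂ β-pos)

  ⟨-β⟩⁻¹ : ℝ
  ⟨-β⟩⁻¹ = inv (- β) (inj₁ -β-neg)

  ℓ : ℝ
  ℓ = - β * inv (β + 1ℝ) (inj₂ β+1-pos)

  -- The next digit ⌊ -βx - ℓ ⌋ of x is n.
  IsDigit : ℝ → ℤ → Set
  IsDigit x n = IsFloor (- β * x - ℓ) n

  -- The graph of T₋β : [ℓ, ℓ+1) → [ℓ, ℓ+1).  A relation, because ⌊_⌋ is
  -- not a total function on ℝ constructively.
  T : ℝ → ℝ → Set
  T x y = (ℓ ≤ x × x < ℓ + 1ℝ) × ∃[ n ] (IsDigit x n × y ≃ - β * x - fromℤ n)

  T^ : ℕ → ℝ → ℝ → Set
  T^ zero    x y = x ≃ y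
  T^ (suc n) x y = ∃[ z ] (T^ n x z × T z y)

  -- d is d₋β(x), with d i the digit x_{i+1}.
  IsDigits : ℝ → (ℕ → ℤ) → Set
  IsDigits x d = ∀ i → ∃[ y ] (T^ i x y × IsDigit y (d i))

  -- x / (-β)ᵏ
  scale : ℝ → ℕ → ℝ
  scale x k = x * ⟨-β⟩⁻¹ ^ k

  Fits : ℝ → ℕ → Set
  Fits x k = ℓ < scale x k × scale x k < ℓ + 1ℝ

  IsExpansion : ℝ → Expansion → Set
  IsExpansion x e =
    ∃[ k ] (Fits x k × (∀ j → j ℕ.< k → ¬ Fits x j) ×
      ∃[ d ] (IsDigits (scale x k) d × e ≡ pointAfter k d))

  HasFiniteExpansion : ℝ → Set
  HasFiniteExpansion x = ∃[ e ] (IsExpansion x e × Finite e)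

  _∈ℤ[β⁻¹] : ℝ → Set
  x ∈ℤ[β⁻¹] = ∃[ p ] x ≃ evalℝ p β⁻¹

  Property-F : Set
  Property-F = ∀ x → x ∈ℤ[β⁻¹] → HasFiniteExpansion x

{-# OPTIONS --safe #-}

-- Put c = 1/(β+1), so that ℓ = -βc and ℓ + 1 = c.  Either hypothesis forces
-- (-β)⁻ⁿ c ∈ ℤ[β⁻¹] for some n: if T^k ℓ = 0, then ℓ = c - 1 is a polynomial
-- in β⁻¹, and if p(β) = 0, then c (p(β) - p(-1)) = ∓c is a polynomial in β.
-- But the orbit of -(-β)⁻ⁿ c reaches -c after n steps with digit 0, and -c is
-- a fixed point of T with digit 1, so the expansion of -(-β)⁻ⁿ c is not finite.
module Submission where

open import Defs
open import Data.Empty using (⊥-elim)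
open import Data.Integer.Base as ℤ using (ℤ; +_; -[1+_]; -1ℤ; ∣_∣)
import Data.Integer.Properties as ℤₚ
open import Data.List.Base using ([]; _∷_; length; map)
open import Data.Nat.Base as ℕ using (ℕ; zero; suc; _∸_) renaming (_≤_ to _≤ℕ_)
import Data.Nat.Properties as ℕₚ
open import Data.Product.Base using (Σ; ∃-syntax; _×_; _,_; proj₁; proj₂)
open import Data.Rational.Base as ℚ using (ℚ; 0ℚ; 1ℚ; ½)
import Data.Rational.Properties as ℚₚ
open import Data.Rational.Solver using (module +-*-Solver)
import Data.Rational.Unnormalised.Base as ℚᵘ
import Data.Rational.Unnormalised.Properties as ℚᵘₚ
open import Data.Sum.Base using (_⊎_; inj₁; inj₂)
open import Relation.Binary.PropositionalEquality
  using (_≡_; refl; sym; trans; cong; cong₂; subst)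
open import Relation.Nullary using (¬_; contradiction)
open import Relation.Binary.Definitions using (Tri; tri<; tri≈; tri>)

open +-*-Solver using (solve; _:=_; _:+_; _:*_; :-_; _:-_; con)

-- Real numbers

-- Eventual agreement suits inverses: `recip` inverts a term only once the sequence has moved away
-- from 0.
eventually≡⇒≃ : ∀ {x y} → Eventually (λ n → seq x n ≡ seq y n) → x ≃ y
eventually≡⇒≃ {x} {y} (N , h) = mk≃ λ ε 0<ε → N , λ n N≤n →
  subst (ℚ._< ε)
    (cong ℚ.∣_∣ (sym (trans (cong (ℚ._- seq y n) (h n N≤n)) (ℚₚ.+-inverseʳ (seq y n)))))
    0<ε

pointwise : ∀ {x y} → (∀ n → seq x n ≡ seq y n) → x ≃ y
pointwise {x} {y} h = eventually≡⇒≃ {x} {y} (0 , λ n _ → h n)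

≃-refl : ∀ {x} → x ≃ x
≃-refl {x} = pointwise {x} {x} λ _ → refl

≃-sym : ∀ {x y} → x ≃ y → y ≃ x
≃-sym {x} {y} (mk≃ h) = mk≃ λ ε 0<ε → let (N , f) = h ε 0<ε in N , λ n N≤n →
  subst (ℚ._< ε)
    (trans (sym (ℚₚ.∣-p∣≡∣p∣ (seq x n ℚ.- seq y n)))
      (cong ℚ.∣_∣ (solve 2 (λ a b → :- (a :- b) := b :- a) refl (seq x n) (seq y n))))
    (f n N≤n)

≃-trans : ∀ {x y z} → x ≃ y → y ≃ z → x ≃ z
≃-trans {x} {y} {z} (mk≃ h) (mk≃ k) = mk≃ λ ε 0<ε →
  let (M , f) = h _ (half-pos 0<ε)
      (N , g) = k _ (half-pos 0<ε)
  in M ℕ.⊔ N , λ n n≥ →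
    subst (λ r → ℚ.∣ r ∣ ℚ.< ε)
      (solve 3 (λ a b c → (a :- b) :+ (b :- c) := a :- c) refl (seq x n) (seq y n) (seq z n))
      (∣+∣< {seq x n ℚ.- seq y n} {seq y n ℚ.- seq z n}
        (f n (ℕₚ.m⊔n≤o⇒m≤o M N n≥)) (g n (ℕₚ.m⊔n≤o⇒n≤o M N n≥)))

+-cong : ∀ {x x′ y y′} → x ≃ x′ → y ≃ y′ → x + y ≃ x′ + y′
+-cong {x} {x′} {y} {y′} (mk≃ h) (mk≃ k) = mk≃ λ ε 0<ε →
  let (M , f) = h _ (half-pos 0<ε)
      (N , g) = k _ (half-pos 0<ε)
  in M ℕ.⊔ N , λ n n≥ →
    subst (λ r → ℚ.∣ r ∣ ℚ.< ε)
      (solve 4 (λ a a′ b b′ → (a :- a′) :+ (b :- b′) := (a :+ b) :- (a′ :+ b′)) refl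
        (seq x n) (seq x′ n) (seq y n) (seq y′ n))
      (∣+∣< {seq x n ℚ.- seq x′ n} {seq y n ℚ.- seq y′ n}
        (f n (ℕₚ.m⊔n≤o⇒m≤o M N n≥)) (g n (ℕₚ.m⊔n≤o⇒n≤o M N n≥)))

*-cong : ∀ {x x′ y y′} → x ≃ x′ → y ≃ y′ → x * y ≃ x′ * y′
*-cong {x} {x′} {y} {y′} (mk≃ h) (mk≃ k) = mk≃ λ ε 0<ε →
  -- `*-close` splits xy - x′y′ as x(y - y′) + y′(x - x′), so the bounds are taken on x and y′.
  let (A , 0<A , M₁ , x≤A) = bounded {seq x} (cauchy x)
      (B , 0<B , M₂ , y≤B) = bounded {seq y′} (cauchy y′)
      (δ , 0<δ , Aδ≡) = ratio 0<A (half-pos 0<ε)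
      (η , 0<η , Bη≡) = ratio 0<B (half-pos 0<ε)
      (N₁ , f) = h η 0<η
      (N₂ , g) = k δ 0<δ
  in (M₁ ℕ.⊔ M₂) ℕ.⊔ (N₁ ℕ.⊔ N₂) , λ n n≥ →
    let nM = ℕₚ.m⊔n≤o⇒m≤o (M₁ ℕ.⊔ M₂) (N₁ ℕ.⊔ N₂) n≥
        nN = ℕₚ.m⊔n≤o⇒n≤o (M₁ ℕ.⊔ M₂) (N₁ ℕ.⊔ N₂) n≥
    in *-close {seq x n} {seq y n} {seq x′ n} {seq y′ n} 0<A 0<B Aδ≡ Bη≡
         (x≤A n (ℕₚ.m⊔n≤o⇒m≤o M₁ M₂ nM))
         (y≤B n (ℕₚ.m⊔n≤o⇒n≤o M₁ M₂ nM))
         (g n (ℕₚ.m⊔n≤o⇒n≤o N₁ N₂ nN))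
         (f n (ℕₚ.m⊔n≤o⇒m≤o N₁ N₂ nN))

-- Reduces an equation modulo the hypothesis r ≃ s, with cofactor k, so that
-- what remains is a polynomial identity, checked pointwise on ℚ.
modulo : ∀ {x y r s} k → r ≃ s → x ≃ y + k * (r - s) → x ≃ y
modulo {x} {y} {r} {s} k r≃s x≃ =
  ≃-trans {x} {y + k * (r - s)} {y} x≃
    (≃-trans {y + k * (r - s)} {y + k * (s - s)} {y}
      (+-cong {y} {y} {k * (r - s)} {k * (s - s)} (≃-refl {y})
        (*-cong {k} {k} {r - s} {s - s} (≃-refl {k})
          (+-cong {r} {s} { - s} { - s} r≃s (≃-refl { - s}))))
      (pointwise λ n → solve 3 (λ y k s → y :+ k :* (s :- s) := y) refl
        (seq y n) (seq k n) (seq s n)))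

-- Order on the reals

-- Comparisons become positivity of a difference, which can then be rewritten with `modulo` as sums
-- and products of positive reals.
<⇒0< : ∀ {x y} → x < y → 0ℝ < y - x
<⇒0< {x} {y} (mk< g 0<g (N , h)) = mk< g 0<g (N , λ n N≤n →
  subst (ℚ._≤ seq y n ℚ.- seq x n)
    (solve 2 (λ a g → a :+ g :- a := con 0ℚ :+ g) refl (seq x n) g)
    (ℚₚ.+-monoˡ-≤ (ℚ.- seq x n) (h n N≤n)))

0<⇒< : ∀ {x y} → 0ℝ < y - x → x < y
0<⇒< {x} {y} (mk< g 0<g (N , h)) = mk< g 0<g (N , λ n N≤n →
  subst₂′ (solve 2 (λ a g → con 0ℚ :+ g :+ a := a :+ g) refl (seq x n) g)
    (solve 2 (λ a b → b :- a :+ a := b) refl (seq x n) (seq y n))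
    (ℚₚ.+-monoˡ-≤ (seq x n) (h n N≤n)))
  where
  subst₂′ : ∀ {p p′ q q′} → p ≡ p′ → q ≡ q′ → p ℚ.≤ q → p′ ℚ.≤ q′
  subst₂′ refl refl p≤q = p≤q

-- Half of the gap g survives: eventually y is at least g and x differs from y by less than g/2.
0<-resp-≃ : ∀ {x y} → x ≃ y → 0ℝ < y → 0ℝ < x
0<-resp-≃ {x} {y} x≃y (mk< g 0<g (N , h)) =
  let mk≃ close = ≃-sym {x} {y} x≃y
      (M , f) = close _ (half-pos 0<g)
  in mk< (g ℚ.* ½) (half-pos 0<g) (M ℕ.⊔ N , λ n n≥ →
       bound (seq x n) (seq y n) (h n (ℕₚ.m⊔n≤o⇒n≤o M N n≥)) (f n (ℕₚ.m⊔n≤o⇒m≤o M N n≥)))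
  where
  open ℚₚ.≤-Reasoning
  bound : ∀ a b → 0ℚ ℚ.+ g ℚ.≤ b → ℚ.∣ b ℚ.- a ∣ ℚ.< g ℚ.* ½ → 0ℚ ℚ.+ g ℚ.* ½ ℚ.≤ a
  bound a b g≤b b-a< = begin
    0ℚ ℚ.+ g ℚ.* ½                    ≡⟨ solve 1 (λ h → con 0ℚ :+ h := con 0ℚ :+ (h :+ h) :- h) refl (g ℚ.* ½) ⟩
    0ℚ ℚ.+ (g ℚ.* ½ ℚ.+ g ℚ.* ½) ℚ.- g ℚ.* ½  ≡⟨ cong (λ q → 0ℚ ℚ.+ q ℚ.- g ℚ.* ½) (halve g) ⟩
    0ℚ ℚ.+ g ℚ.- g ℚ.* ½              ≤⟨ ℚₚ.+-mono-≤ g≤b (ℚₚ.neg-antimono-≤ (ℚₚ.<⇒≤ b-a<)) ⟩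
    b ℚ.- ℚ.∣ b ℚ.- a ∣               ≤⟨ ℚₚ.+-monoʳ-≤ b (ℚₚ.neg-antimono-≤ (p≤∣p∣ (b ℚ.- a))) ⟩
    b ℚ.- (b ℚ.- a)                   ≡⟨ solve 2 (λ a b → b :- (b :- a) := a) refl a b ⟩
    a                                 ∎
    where
    p≤∣p∣ : ∀ p → p ℚ.≤ ℚ.∣ p ∣
    p≤∣p∣ p with ℚₚ.≤-total 0ℚ p
    ... | inj₁ 0≤p = ℚₚ.≤-reflexive (sym (ℚₚ.0≤p⇒∣p∣≡p 0≤p))
    ... | inj₂ p≤0 = ℚₚ.≤-trans p≤0 (ℚₚ.0≤∣p∣ p)

0<+ : ∀ {x y} → 0ℝ < x → 0ℝ < y → 0ℝ < x + y
0<+ {x} {y} (mk< g 0<g (M , h)) (mk< g′ 0<g′ (N , k)) =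
  mk< (g ℚ.+ g′) (ℚₚ.+-mono-< 0<g 0<g′) (M ℕ.⊔ N , λ n n≥ →
    subst (ℚ._≤ seq x n ℚ.+ seq y n)
      (solve 2 (λ g g′ → (con 0ℚ :+ g) :+ (con 0ℚ :+ g′) := con 0ℚ :+ (g :+ g′)) refl g g′)
      (ℚₚ.+-mono-≤ (h n (ℕₚ.m⊔n≤o⇒m≤o M N n≥)) (k n (ℕₚ.m⊔n≤o⇒n≤o M N n≥))))

0<* : ∀ {x y} → 0ℝ < x → 0ℝ < y → 0ℝ < x * y
0<* {x} {y} (mk< g 0<g (M , h)) (mk< g′ 0<g′ (N , k)) =
  mk< (g ℚ.* g′) (*-pos 0<g 0<g′) (M ℕ.⊔ N , λ n n≥ →
    bound (seq x n) (seq y n)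
      (subst (ℚ._≤ seq x n) (ℚₚ.+-identityˡ g) (h n (ℕₚ.m⊔n≤o⇒m≤o M N n≥)))
      (subst (ℚ._≤ seq y n) (ℚₚ.+-identityˡ g′) (k n (ℕₚ.m⊔n≤o⇒n≤o M N n≥))))
  where
  open ℚₚ.≤-Reasoning
  bound : ∀ a b → g ℚ.≤ a → g′ ℚ.≤ b → 0ℚ ℚ.+ g ℚ.* g′ ℚ.≤ a ℚ.* b
  bound a b g≤a g′≤b = begin
    0ℚ ℚ.+ g ℚ.* g′  ≡⟨ ℚₚ.+-identityˡ _ ⟩
    g ℚ.* g′         ≤⟨ ℚₚ.*-monoʳ-≤-nonNeg g′ {{ℚ.nonNegative (ℚₚ.<⇒≤ 0<g′)}} g≤a ⟩
    a ℚ.* g′         ≤⟨ ℚₚ.*-monoˡ-≤-nonNeg a {{ℚ.nonNegative (ℚₚ.≤-trans (ℚₚ.<⇒≤ 0<g) g≤a)}} g′≤b ⟩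
    a ℚ.* b          ∎

0≮0 : ¬ (0ℝ < 0ℝ)
0≮0 (mk< g 0<g (N , h)) = ℚₚ.<-irrefl refl
  (ℚₚ.<-≤-trans 0<g (subst (ℚ._≤ 0ℚ) (ℚₚ.+-identityˡ g) (h N ℕₚ.≤-refl)))

<-asym : ∀ {x y} → x < y → ¬ (y < x)
<-asym {x} {y} x<y y<x = 0≮0 (0<-resp-≃ {0ℝ} {(y - x) + (x - y)}
  (pointwise λ n → solve 2 (λ a b → con 0ℚ := (b :- a) :+ (a :- b)) refl (seq x n) (seq y n))
  (0<+ {y - x} {x - y} (<⇒0< {x} {y} x<y) (<⇒0< {y} {x} y<x)))

-- Deciding definitional equality of compound reals compares their Cauchy proofs
-- and blows up; hence y and a pointwise equation in place of inv x.
inverseʳ : ∀ x y → 0ℝ < x → (∀ n → seq y n ≡ recip (seq x n)) → x * y ≃ 1ℝ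
inverseʳ x y (mk< g 0<g (N , h)) y≡ =
  eventually≡⇒≃ {x * y} {1ℝ} (N , λ n N≤n →
    trans (cong (seq x n ℚ.*_) (y≡ n)) (recip-inverseʳ λ x≡0 →
      ℚₚ.<-irrefl refl (ℚₚ.<-≤-trans 0<g
        (subst (ℚ._≤ 0ℚ) (ℚₚ.+-identityˡ g) (subst (0ℚ ℚ.+ g ℚ.≤_) x≡0 (h n N≤n))))))

-- If B eventually bounds x, then δ = 1/B is a gap for the inverse: a δ ≤ B δ = 1 = a · `recip a`
-- for each late term a, and a > 0 cancels.
0<inverse : ∀ x y → 0ℝ < x → (∀ n → seq y n ≡ recip (seq x n)) → 0ℝ < y
0<inverse x y (mk< g 0<g (N , h)) y≡ =
  let (B , 0<B , M , x≤B) = bounded {seq x} (cauchy x)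
      (δ , 0<δ , Bδ≡1) = ratio 0<B (ℚₚ.positive⁻¹ 1ℚ)
  in mk< δ 0<δ (M ℕ.⊔ N , λ n n≥ → subst (0ℚ ℚ.+ δ ℚ.≤_) (sym (y≡ n)) (bound B δ (ℚₚ.<⇒≤ 0<δ) Bδ≡1 (seq x n)
       (ℚₚ.<-≤-trans 0<g (subst (ℚ._≤ seq x n) (ℚₚ.+-identityˡ g) (h n (ℕₚ.m⊔n≤o⇒n≤o M N n≥))))
       (x≤B n (ℕₚ.m⊔n≤o⇒m≤o M N n≥))))
  where
  open ℚₚ.≤-Reasoning
  bound : ∀ B δ → 0ℚ ℚ.≤ δ → B ℚ.* δ ≡ 1ℚ → ∀ a → 0ℚ ℚ.< a → ℚ.∣ a ∣ ℚ.≤ B →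
          0ℚ ℚ.+ δ ℚ.≤ recip a
  bound B δ 0≤δ Bδ≡1 a 0<a a≤B = ℚₚ.*-cancelˡ-≤-pos a {{ℚ.positive 0<a}} (begin
    a ℚ.* (0ℚ ℚ.+ δ)  ≡⟨ cong (a ℚ.*_) (ℚₚ.+-identityˡ δ) ⟩
    a ℚ.* δ           ≤⟨ ℚₚ.*-monoʳ-≤-nonNeg δ {{ℚ.nonNegative 0≤δ}}
                           (subst (ℚ._≤ B) (ℚₚ.0≤p⇒∣p∣≡p (ℚₚ.<⇒≤ 0<a)) a≤B) ⟩
    B ℚ.* δ           ≡⟨ Bδ≡1 ⟩
    1ℚ                ≡⟨ recip-inverseʳ (λ a≡0 → ℚₚ.<-irrefl (sym a≡0) 0<a) ⟨
    a ℚ.* recip a     ∎)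

-- Integers and floors

-- `ℚ./` normalises its result, so the equation is transferred to unnormalised rationals, where
-- every denominator is 1.
/1-homo-+ : ∀ i j → (i ℤ.+ j) ℚ./ 1 ≡ i ℚ./ 1 ℚ.+ j ℚ./ 1
/1-homo-+ i j = ℚₚ.toℚᵘ-injective (begin
  ℚ.toℚᵘ ((i ℤ.+ j) ℚ./ 1)                    ≈⟨ ℚₚ.toℚᵘ-fromℚᵘ (ℚᵘ.mkℚᵘ (i ℤ.+ j) 0) ⟩
  ℚᵘ.mkℚᵘ (i ℤ.+ j) 0                         ≈⟨ ℚᵘ.*≡* (cong (ℤ._* + 1)
                                                  (cong₂ ℤ._+_ (sym (ℤₚ.*-identityʳ i)) (sym (ℤₚ.*-identityʳ j)))) ⟩
  ℚᵘ.mkℚᵘ i 0 ℚᵘ.+ ℚᵘ.mkℚᵘ j 0                ≈⟨ ℚᵘₚ.+-cong (ℚₚ.toℚᵘ-fromℚᵘ (ℚᵘ.mkℚᵘ i 0)) (ℚₚ.toℚᵘ-fromℚᵘ (ℚᵘ.mkℚᵘ j 0)) ⟨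
  ℚ.toℚᵘ (i ℚ./ 1) ℚᵘ.+ ℚ.toℚᵘ (j ℚ./ 1)      ≈⟨ ℚₚ.toℚᵘ-homo-+ (i ℚ./ 1) (j ℚ./ 1) ⟨
  ℚ.toℚᵘ (i ℚ./ 1 ℚ.+ j ℚ./ 1)                ∎)
  where open import Relation.Binary.Reasoning.Setoid ℚᵘₚ.≃-setoid

/1-homo-neg : ∀ i → (ℤ.- i) ℚ./ 1 ≡ ℚ.- (i ℚ./ 1)
/1-homo-neg i =
  trans (solve 2 (λ p q → q := p :+ q :- p) refl (i ℚ./ 1) ((ℤ.- i) ℚ./ 1))
    (trans (cong (ℚ._- i ℚ./ 1) (trans (sym (/1-homo-+ i (ℤ.- i))) (cong (ℚ._/ 1) (ℤₚ.+-inverseʳ i))))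
      (ℚₚ.+-identityˡ (ℚ.- (i ℚ./ 1))))

/1-mono-≤ : ∀ {i j} → i ℤ.≤ j → i ℚ./ 1 ℚ.≤ j ℚ./ 1
/1-mono-≤ {i} {j} i≤j = ℚₚ.toℚᵘ-cancel-≤
  (ℚᵘₚ.≤-respˡ-≃ (ℚᵘₚ.≃-sym (ℚₚ.toℚᵘ-fromℚᵘ (ℚᵘ.mkℚᵘ i 0)))
    (ℚᵘₚ.≤-respʳ-≃ (ℚᵘₚ.≃-sym (ℚₚ.toℚᵘ-fromℚᵘ (ℚᵘ.mkℚᵘ j 0)))
      (ℚᵘ.*≤* (ℤₚ.*-monoʳ-≤-nonNeg (+ 1) i≤j))))

<-floor-mono : ∀ x i j → x < fromℤ i + 1ℝ → i ℤ.< j → x < fromℤ j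
<-floor-mono x i j (mk< g 0<g (N , h)) i<j =
  mk< g 0<g (N , λ n N≤n → ℚₚ.≤-trans (h n N≤n) i+1≤j)
  where
  open ℚₚ.≤-Reasoning
  i+1≤j : i ℚ./ 1 ℚ.+ 1ℚ ℚ.≤ j ℚ./ 1
  i+1≤j = begin
    i ℚ./ 1 ℚ.+ 1ℚ     ≡⟨ /1-homo-+ i (+ 1) ⟨
    (i ℤ.+ + 1) ℚ./ 1  ≡⟨ cong (ℚ._/ 1) (ℤₚ.+-comm i (+ 1)) ⟩
    ℤ.suc i ℚ./ 1      ≤⟨ /1-mono-≤ {ℤ.suc i} {j} (ℤₚ.i<j⇒suc[i]≤j i<j) ⟩
    j ℚ./ 1            ∎

-- If i < j, then x < i + 1 ≤ j contradicts j ≤ x. This is what makes the relation `T` deterministic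
-- up to `≃`.
floor-unique : ∀ x i j → IsFloor x i → IsFloor x j → i ≡ j
floor-unique x i j (i≤x , x<i+1) (j≤x , x<j+1) = compare (ℤₚ.<-cmp i j)
  where
  compare : Tri (i ℤ.< j) (i ≡ j) (j ℤ.< i) → i ≡ j
  compare (tri< i<j _ _) = ⊥-elim (j≤x (<-floor-mono x i j x<i+1 i<j))
  compare (tri≈ _ i≡j _) = i≡j
  compare (tri> _ _ j<i) = ⊥-elim (i≤x (<-floor-mono x j i x<j+1 j<i))

-- Since `≤` is a negated `<`, a strict lower bound gives the weak one by asymmetry. The orbit
-- points considered below satisfy both bounds strictly.
strict⇒IsFloor : ∀ x i → 0ℝ < x - fromℤ i → 0ℝ < fromℤ i + 1ℝ - x → IsFloor x i
strict⇒IsFloor x i l u =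
  <-asym {fromℤ i} {x} (0<⇒< {fromℤ i} {x} l) , 0<⇒< {x} {fromℤ i + 1ℝ} u

∣i∣≡1⇒i≡±1 : ∀ i → ∣ i ∣ ≡ 1 → i ≡ + 1 ⊎ i ≡ -1ℤ
∣i∣≡1⇒i≡±1 (+ _)    refl = inj₁ refl
∣i∣≡1⇒i≡±1 -[1+ _ ] refl = inj₂ refl

-- Arithmetic of integer polynomials

infixl 6 _⊕_

_⊕_ : ℤ[X] → ℤ[X] → ℤ[X]
[]      ⊕ q       = q
(a ∷ p) ⊕ []      = a ∷ p
(a ∷ p) ⊕ (b ∷ q) = (a ℤ.+ b) ∷ (p ⊕ q)

evalℝ-⊕ : ∀ p q x n → seq (evalℝ (p ⊕ q) x) n ≡ seq (evalℝ p x + evalℝ q x) n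
evalℝ-⊕ []      q       x n = sym (ℚₚ.+-identityˡ _)
evalℝ-⊕ (a ∷ p) []      x n = sym (ℚₚ.+-identityʳ _)
evalℝ-⊕ (a ∷ p) (b ∷ q) x n = trans
  (cong₂ (λ u v → u ℚ.+ seq x n ℚ.* v) (/1-homo-+ a b) (evalℝ-⊕ p q x n))
  (solve 5 (λ a b x p q → a :+ b :+ x :* (p :+ q) := (a :+ x :* p) :+ (b :+ x :* q)) refl
    (a ℚ./ 1) (b ℚ./ 1) (seq x n) (seq (evalℝ p x) n) (seq (evalℝ q x) n))

evalℝ-neg : ∀ p x n → seq (evalℝ (map ℤ.-_ p) x) n ≡ seq (- evalℝ p x) n
evalℝ-neg []      x n = refl
evalℝ-neg (a ∷ p) x n = trans
  (cong₂ (λ u v → u ℚ.+ seq x n ℚ.* v) (/1-homo-neg a) (evalℝ-neg p x n))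
  (solve 3 (λ a x p → :- a :+ x :* :- p := :- (a :+ x :* p)) refl
    (a ℚ./ 1) (seq x n) (seq (evalℝ p x) n))

module _ (β : ℝ) (1<β : 1ℝ < β) where
  open NegativeBase β 1<β hiding (β⁻¹; ℓ)
  open NegativeBase using (β⁻¹; ℓ)

  private
    -- Here r is (-β)⁻¹, written as - β⁻¹ so that multiplication by it visibly preserves ℤ[β⁻¹].
    b c r l : ℝ
    b = β⁻¹ β 1<β
    c = inv (β + 1ℝ) (inj₂ β+1-pos)
    r = - b
    l = ℓ β 1<β

    βb≃1 : β * b ≃ 1ℝ
    βb≃1 = inverseʳ β b β-pos λ _ → refl

    [β+1]c≃1 : (β + 1ℝ) * c ≃ 1ℝ
    [β+1]c≃1 = inverseʳ (β + 1ℝ) c β+1-pos λ _ → refl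

    0<b : 0ℝ < b
    0<b = 0<inverse β b β-pos λ _ → refl

    0<c : 0ℝ < c
    0<c = 0<inverse (β + 1ℝ) c β+1-pos λ _ → refl

    0<β-1 : 0ℝ < β - 1ℝ
    0<β-1 = <⇒0< {1ℝ} {β} 1<β

  -- The ring ℤ[β⁻¹]

  -- Unfolds to the same type as `_∈ℤ[β⁻¹]`, so membership proofs can be passed directly to
  -- `Property-F`.
  _∈ℤ[b] : ℝ → Set
  x ∈ℤ[b] = ∃[ p ] x ≃ evalℝ p b

  ∈-resp-≃ : ∀ {x y} → x ≃ y → y ∈ℤ[b] → x ∈ℤ[b]
  ∈-resp-≃ {x} {y} x≃y (p , y≃p) = p , ≃-trans {x} {y} {evalℝ p b} x≃y y≃p

  fromℤ∈ : ∀ i → fromℤ i ∈ℤ[b]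
  fromℤ∈ i = i ∷ [] , pointwise λ n →
    solve 2 (λ i b → i := i :+ b :* con 0ℚ) refl (i ℚ./ 1) (seq b n)

  +∈ : ∀ {x y} → x ∈ℤ[b] → y ∈ℤ[b] → (x + y) ∈ℤ[b]
  +∈ {x} {y} (p , x≃p) (q , y≃q) = p ⊕ q ,
    ≃-trans {x + y} {evalℝ p b + evalℝ q b} {evalℝ (p ⊕ q) b}
      (+-cong {x} {evalℝ p b} {y} {evalℝ q b} x≃p y≃q)
      (pointwise λ n → sym (evalℝ-⊕ p q b n))

  neg∈ : ∀ {x} → x ∈ℤ[b] → (- x) ∈ℤ[b]
  neg∈ {x} (p , x≃p) = map ℤ.-_ p ,
    ≃-trans { - x} { - evalℝ p b} {evalℝ (map ℤ.-_ p) b}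
      (modulo { - x} { - evalℝ p b} {x} {evalℝ p b} (- 1ℝ) x≃p
        (pointwise λ n → solve 2 (λ x p → :- x := :- p :+ :- con 1ℚ :* (x :- p)) refl
          (seq x n) (seq (evalℝ p b) n)))
      (pointwise λ n → sym (evalℝ-neg p b n))

  -- Multiplication by β⁻¹ prepends a zero coefficient; `neg∈` supplies the sign.
  r*∈ : ∀ {x} → x ∈ℤ[b] → (r * x) ∈ℤ[b]
  r*∈ {x} (p , x≃p) = ∈-resp-≃ {r * x} { - evalℝ (+ 0 ∷ p) b}
    (modulo {r * x} { - evalℝ (+ 0 ∷ p) b} {x} {evalℝ p b} r x≃p
      (pointwise λ n → solve 3
        (λ b x p → :- b :* x := :- (con 0ℚ :+ b :* p) :+ :- b :* (x :- p)) refl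
        (seq b n) (seq x n) (seq (evalℝ p b) n)))
    (neg∈ {evalℝ (+ 0 ∷ p) b} (+ 0 ∷ p , ≃-refl {evalℝ (+ 0 ∷ p) b}))

  r^*fromℤ∈ : ∀ m i → (r ^ m * fromℤ i) ∈ℤ[b]
  r^*fromℤ∈ zero i = ∈-resp-≃ {r ^ zero * fromℤ i} {fromℤ i}
    (pointwise λ n → ℚₚ.*-identityˡ _) (fromℤ∈ i)
  r^*fromℤ∈ (suc m) i = ∈-resp-≃ {r ^ suc m * fromℤ i} {r * (r ^ m * fromℤ i)}
    (pointwise λ n → ℚₚ.*-assoc (seq r n) (seq (r ^ m) n) _)
    (r*∈ {r ^ m * fromℤ i} (r^*fromℤ∈ m i))

  -- Multiples of c in ℤ[β⁻¹]

  -- Inverting a step y = -βz - i of `T` gives z = r(y + i). Iterating, the difference is the sum of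
  -- the first k digits weighted by powers of r.
  T^-ℓ∈ : ∀ k {y} → T^ k (ℓ β 1<β) y → (l - r ^ k * y) ∈ℤ[b]
  T^-ℓ∈ zero {y} ℓ≃y = ∈-resp-≃ {l - r ^ zero * y} {fromℤ (+ 0)}
    (modulo {l - r ^ zero * y} {fromℤ (+ 0)} {l} {y} 1ℝ ℓ≃y
      (pointwise λ n → solve 2
        (λ l y → l :- con 1ℚ :* y := con 0ℚ :+ con 1ℚ :* (l :- y)) refl (seq l n) (seq y n)))
    (fromℤ∈ (+ 0))
  T^-ℓ∈ (suc k) {y} (z , ℓ↦z , _ , i , _ , y≃) =
    let w = r ^ k
        target = (l - w * z) + r * (w * fromℤ i)
    in ∈-resp-≃ {l - r ^ suc k * y} {target}
      (modulo {l - r ^ suc k * y} {target} {y} { - β * z - fromℤ i} (- (r ^ suc k)) y≃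
        (modulo {l - r ^ suc k * y} {target + - (r ^ suc k) * (y - (- β * z - fromℤ i))}
          {β * b} {1ℝ} (- (w * z)) βb≃1
          (pointwise λ n → solve 7
            (λ β b l w z y i →
              l :- (:- b :* w) :* y :=
              ((l :- w :* z) :+ :- b :* (w :* i)
                :+ :- (:- b :* w) :* (y :- (:- β :* z :- i)))
                :+ :- (w :* z) :* (β :* b :- con 1ℚ)) refl
            (seq β n) (seq b n) (seq l n) (seq w n) (seq z n) (seq y n) (i ℚ./ 1))))
      (+∈ {l - w * z} {r * (w * fromℤ i)} (T^-ℓ∈ k ℓ↦z)
        (r*∈ {w * fromℤ i} (r^*fromℤ∈ k i)))

  -- The remainder in `T^-ℓ∈` vanishes, which puts ℓ in ℤ[β⁻¹]; then c = ℓ + 1 because (β + 1)c = 1.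
  -- The factor `r ^ 0` matches the form used by `r^c∈⇒¬Property-F`.
  T^ℓ≃0⇒c∈ : ∀ k → T^ k (ℓ β 1<β) 0ℝ → (r ^ 0 * c) ∈ℤ[b]
  T^ℓ≃0⇒c∈ k ℓ↦0 = ∈-resp-≃ {r ^ 0 * c} {(l - r ^ k * 0ℝ) + fromℤ (+ 1)}
    (modulo {r ^ 0 * c} {(l - r ^ k * 0ℝ) + fromℤ (+ 1)} {(β + 1ℝ) * c} {1ℝ} 1ℝ [β+1]c≃1
      (pointwise λ n → solve 3
        (λ β c w →
          con 1ℚ :* c := (:- β :* c :- w :* con 0ℚ) :+ con 1ℚ
            :+ con 1ℚ :* ((β :+ con 1ℚ) :* c :- con 1ℚ)) refl
        (seq β n) (seq c n) (seq (r ^ k) n)))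
    (+∈ {l - r ^ k * 0ℝ} {fromℤ (+ 1)} (T^-ℓ∈ k ℓ↦0) (fromℤ∈ (+ 1)))

  -- For p = a + X q, one has p(β) - p(-1) = β (q(β) - q(-1)) + (β+1) q(-1).
  c[p[β]-p[-1]]∈ : ∀ p → (r ^ length p * (c * (evalℝ p β - fromℤ (evalℤ p -1ℤ)))) ∈ℤ[b]
  c[p[β]-p[-1]]∈ [] = ∈-resp-≃ {r ^ length {A = ℤ} [] * (c * (evalℝ [] β - fromℤ (evalℤ [] -1ℤ)))} {fromℤ (+ 0)}
    (pointwise λ n → solve 1
      (λ c → con 1ℚ :* (c :* (con 0ℚ :- con 0ℚ)) := con 0ℚ) refl (seq c n))
    (fromℤ∈ (+ 0))
  c[p[β]-p[-1]]∈ (a ∷ p) =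
    let w = r ^ length p
        P = evalℝ p β
        E = fromℤ (evalℤ p -1ℤ)
        source = r ^ length (a ∷ p) * (c * (evalℝ (a ∷ p) β - fromℤ (evalℤ (a ∷ p) -1ℤ)))
        -- After multiplication by r w c, the summand β(P - E) simplifies by r β = -1 and the
        -- summand (β + 1)E by c(β + 1) = 1. Each coefficient thus costs one factor r, whence the
        -- exponent `length p`.
        target = - (w * (c * (P - E))) + r * (w * E)
    in ∈-resp-≃ {source} {target}
      (modulo {source} {target} {β * b} {1ℝ} (- (w * (c * (P - E)))) βb≃1
        (modulo {source} {target + - (w * (c * (P - E))) * (β * b - 1ℝ)}
          {(β + 1ℝ) * c} {1ℝ} (r * (w * E)) [β+1]c≃1
          (pointwise λ n → trans
            (cong (λ e → (seq r n ℚ.* seq w n) ℚ.* (seq c n ℚ.* ((a ℚ./ 1 ℚ.+ seq β n ℚ.* seq P n) ℚ.- e)))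
              evalℤ-∷)
            (solve 7
              (λ β b c w a P E →
                (:- b :* w) :* (c :* ((a :+ β :* P) :- (a :- E))) :=
                (:- (w :* (c :* (P :- E))) :+ :- b :* (w :* E)
                  :+ :- (w :* (c :* (P :- E))) :* (β :* b :- con 1ℚ))
                  :+ (:- b :* (w :* E)) :* ((β :+ con 1ℚ) :* c :- con 1ℚ)) refl
              (seq β n) (seq b n) (seq c n) (seq w n) (a ℚ./ 1) (seq P n) (seq E n)))))
      (+∈ { - (w * (c * (P - E)))} {r * (w * E)}
        (neg∈ {w * (c * (P - E))} (c[p[β]-p[-1]]∈ p))
        (r*∈ {w * E} (r^*fromℤ∈ (length p) (evalℤ p -1ℤ))))
    where
    evalℤ-∷ : evalℤ (a ∷ p) -1ℤ ℚ./ 1 ≡ a ℚ./ 1 ℚ.- evalℤ p -1ℤ ℚ./ 1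
    evalℤ-∷ = trans (/1-homo-+ a (-1ℤ ℤ.* evalℤ p -1ℤ))
      (cong (a ℚ./ 1 ℚ.+_)
        (trans (cong (ℚ._/ 1) (ℤₚ.-1*i≡-i (evalℤ p -1ℤ))) (/1-homo-neg (evalℤ p -1ℤ))))

  -- At a root, p(β) - p(-1) is -1 or 1, so the element of `c[p[β]-p[-1]]∈` is the wanted one up to
  -- sign.
  p[β]≃0⇒c∈ : ∀ p → evalℝ p β ≃ 0ℝ → ∣ evalℤ p -1ℤ ∣ ≡ 1 → (r ^ length p * c) ∈ℤ[b]
  p[β]≃0⇒c∈ p p≃0 ∣e∣≡1 = sign (evalℤ p -1ℤ) (∣i∣≡1⇒i≡±1 _ ∣e∣≡1) (c[p[β]-p[-1]]∈ p)
    where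
    -- The value p(-1) is abstracted to e so that matching on `refl` replaces it by 1 or -1.
    sign : ∀ e → e ≡ + 1 ⊎ e ≡ -1ℤ → (r ^ length p * (c * (evalℝ p β - fromℤ e))) ∈ℤ[b] → (r ^ length p * c) ∈ℤ[b]
    sign _ (inj₁ refl) h =
      let w = r ^ length p
          P = evalℝ p β
      in ∈-resp-≃ {w * c} { - (w * (c * (P - fromℤ (+ 1))))}
      (modulo {w * c} { - (w * (c * (P - fromℤ (+ 1))))} {P} {0ℝ} (w * c) p≃0
        (pointwise λ n → solve 3
          (λ c w P → w :* c := :- (w :* (c :* (P :- con 1ℚ))) :+ (w :* c) :* (P :- con 0ℚ)) refl
          (seq c n) (seq w n) (seq P n)))
      (neg∈ {w * (c * (P - fromℤ (+ 1)))} h)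
    sign _ (inj₂ refl) h =
      let w = r ^ length p
          P = evalℝ p β
      in ∈-resp-≃ {w * c} {w * (c * (P - fromℤ -1ℤ))}
      (modulo {w * c} {w * (c * (P - fromℤ -1ℤ))} {P} {0ℝ} (- (w * c)) p≃0
        (pointwise λ n → solve 3
          (λ c w P → w :* c := w :* (c :* (P :- :- con 1ℚ)) :+ :- (w :* c) :* (P :- con 0ℚ)) refl
          (seq c n) (seq w n) (seq P n)))
      h

  -- The orbit of -(-β)⁻ⁿ c

  -- Divided by c, the inequalities ℓ < -(r^m c) < ℓ + 1 read -1 < r^m < β. As r is negative, each
  -- bound for one power yields the opposite bound for the next, so both are proved together.
  r^-bounds : ∀ m → 0ℝ < 1ℝ + r ^ m × 0ℝ < β - r ^ m
  r^-bounds zero = mk< 1ℚ (ℚₚ.positive⁻¹ 1ℚ) (0 , λ _ _ → ℚₚ.+-monoˡ-≤ 1ℚ (ℚₚ.<⇒≤ (ℚₚ.positive⁻¹ 1ℚ))) ,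
    0<-resp-≃ {β - r ^ zero} {β - 1ℝ} (pointwise λ _ → refl) 0<β-1
  r^-bounds (suc m) =
    let w = r ^ m
        (0<1+w , 0<β-w) = r^-bounds m
        lower = b * (β - w)
        -- The last two summands add up to β - b, because b β = 1.
        upper = b * (1ℝ + w) + ((β - 1ℝ) + b * (β - 1ℝ))
    in 0<-resp-≃ {1ℝ + r ^ suc m} {lower}
         (modulo {1ℝ + r ^ suc m} {lower} {β * b} {1ℝ} (- 1ℝ) βb≃1
           (pointwise λ n → solve 3
             (λ β b w → con 1ℚ :+ :- b :* w :=
               b :* (β :- w) :+ :- con 1ℚ :* (β :* b :- con 1ℚ)) refl
             (seq β n) (seq b n) (seq w n)))
         (0<* {b} {β - w} 0<b 0<β-w)
     , 0<-resp-≃ {β - r ^ suc m} {upper}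
         (modulo {β - r ^ suc m} {upper} {β * b} {1ℝ} (- 1ℝ) βb≃1
           (pointwise λ n → solve 3
             (λ β b w → β :- :- b :* w :=
               b :* (con 1ℚ :+ w) :+ ((β :- con 1ℚ) :+ b :* (β :- con 1ℚ))
                 :+ :- con 1ℚ :* (β :* b :- con 1ℚ)) refl
             (seq β n) (seq b n) (seq w n)))
         (0<+ {b * (1ℝ + w)} {(β - 1ℝ) + b * (β - 1ℝ)} (0<* {b} {1ℝ + w} 0<b 0<1+w)
           (0<+ {β - 1ℝ} {b * (β - 1ℝ)} 0<β-1 (0<* {b} {β - 1ℝ} 0<b 0<β-1)))

  -- This forces the minimal shift to be 0, so the expansion of -(r^m c) consists of the digits
  -- along its own orbit. The distances to the endpoints are c(β - w) and c(1 + w), where w = r^m.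
  fits : ∀ m → Fits (- (r ^ m * c)) 0
  fits m =
    let w = r ^ m
        (0<1+w , 0<β-w) = r^-bounds m
        x = scale (- (w * c)) 0
    in 0<⇒< {ℓ β 1<β} {x} (0<-resp-≃ {x - ℓ β 1<β} {c * (β - w)}
         (pointwise λ n → solve 3
           (λ β c w → :- (w :* c) :* con 1ℚ :- (:- β :* c) := c :* (β :- w)) refl
           (seq β n) (seq c n) (seq w n))
         (0<* {c} {β - w} 0<c 0<β-w))
     , 0<⇒< {x} {ℓ β 1<β + 1ℝ} (0<-resp-≃ {ℓ β 1<β + 1ℝ - x} {c * (1ℝ + w)}
         (modulo {ℓ β 1<β + 1ℝ - x} {c * (1ℝ + w)} {(β + 1ℝ) * c} {1ℝ} (- 1ℝ) [β+1]c≃1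
           (pointwise λ n → solve 3
             (λ β c w → (:- β :* c) :+ con 1ℚ :- :- (w :* c) :* con 1ℚ :=
               c :* (con 1ℚ :+ w) :+ :- con 1ℚ :* ((β :+ con 1ℚ) :* c :- con 1ℚ)) refl
             (seq β n) (seq c n) (seq w n)))
         (0<* {c} {1ℝ + w} 0<c 0<1+w))

  -- Indexed by the exponent m of the point -(r^m c), not by the position in the expansion.
  orbitDigit : ℕ → ℤ
  orbitDigit zero    = + 1
  orbitDigit (suc _) = + 0

  -- At -c, the value -βy - ℓ is 2βc = 1 + c(β - 1) = 2 - 2c. At -(r^(m+1) c) it is c(β - w) = 1 -
  -- c(1 + w) with w = r^m, strictly between 0 and 1 by `r^-bounds`.
  isOrbitDigit : ∀ m {y} → y ≃ - (r ^ m * c) → IsDigit y (orbitDigit m)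
  isOrbitDigit zero {y} y≃ =
    let u = - β * y - ℓ β 1<β
    in strict⇒IsFloor u (orbitDigit zero)
    (0<-resp-≃ {u - fromℤ (orbitDigit zero)} {c * (β - 1ℝ)}
      (modulo {u - fromℤ (orbitDigit zero)} {c * (β - 1ℝ)} {y} { - (r ^ zero * c)} (- β) y≃
        (modulo {u - fromℤ (orbitDigit zero)} {c * (β - 1ℝ) + - β * (y - - (r ^ zero * c))} {(β + 1ℝ) * c} {1ℝ} 1ℝ [β+1]c≃1
          (pointwise λ n → solve 3
            (λ β c y → :- β :* y :- :- β :* c :- con 1ℚ :=
              c :* (β :- con 1ℚ) :+ :- β :* (y :- :- (con 1ℚ :* c))
                :+ con 1ℚ :* ((β :+ con 1ℚ) :* c :- con 1ℚ)) refl
            (seq β n) (seq c n) (seq y n))))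
      (0<* {c} {β - 1ℝ} 0<c 0<β-1))
    (0<-resp-≃ {fromℤ (orbitDigit zero) + 1ℝ - u} {c + c}
      (modulo {fromℤ (orbitDigit zero) + 1ℝ - u} {c + c} {y} { - (r ^ zero * c)} β y≃
        (modulo {fromℤ (orbitDigit zero) + 1ℝ - u} {c + c + β * (y - - (r ^ zero * c))} {(β + 1ℝ) * c} {1ℝ}
          (- (1ℝ + 1ℝ)) [β+1]c≃1
          (pointwise λ n → solve 3
            (λ β c y → con 1ℚ :+ con 1ℚ :- (:- β :* y :- :- β :* c) :=
              c :+ c :+ β :* (y :- :- (con 1ℚ :* c))
                :+ :- (con 1ℚ :+ con 1ℚ) :* ((β :+ con 1ℚ) :* c :- con 1ℚ)) refl
            (seq β n) (seq c n) (seq y n))))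
      (0<+ {c} {c} 0<c 0<c))
  isOrbitDigit (suc m) {y} y≃ =
    let w = r ^ m
        u = - β * y - ℓ β 1<β
    in strict⇒IsFloor u (orbitDigit (suc m))
    (0<-resp-≃ {u - fromℤ (orbitDigit (suc m))} {c * (β - w)}
      (modulo {u - fromℤ (orbitDigit (suc m))} {c * (β - w)} {y} { - (r ^ suc m * c)} (- β) y≃
        (modulo {u - fromℤ (orbitDigit (suc m))} {c * (β - w) + - β * (y - - (r ^ suc m * c))} {β * b} {1ℝ} (- (c * w)) βb≃1
          (pointwise λ n → solve 5
            (λ β b c w y → :- β :* y :- :- β :* c :- con 0ℚ :=
              c :* (β :- w) :+ :- β :* (y :- :- (:- b :* w :* c))
                :+ :- (c :* w) :* (β :* b :- con 1ℚ)) refl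
            (seq β n) (seq b n) (seq c n) (seq w n) (seq y n))))
      (0<* {c} {β - w} 0<c (proj₂ (r^-bounds m))))
    (0<-resp-≃ {fromℤ (orbitDigit (suc m)) + 1ℝ - u} {c * (1ℝ + w)}
      (modulo {fromℤ (orbitDigit (suc m)) + 1ℝ - u} {c * (1ℝ + w)} {y} { - (r ^ suc m * c)} β y≃
        (modulo {fromℤ (orbitDigit (suc m)) + 1ℝ - u} {c * (1ℝ + w) + β * (y - - (r ^ suc m * c))} {β * b} {1ℝ} (c * w) βb≃1
          (modulo {fromℤ (orbitDigit (suc m)) + 1ℝ - u}
            {c * (1ℝ + w) + β * (y - - (r ^ suc m * c)) + (c * w) * (β * b - 1ℝ)}
            {(β + 1ℝ) * c} {1ℝ} (- 1ℝ) [β+1]c≃1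
            (pointwise λ n → solve 5
              (λ β b c w y → con 0ℚ :+ con 1ℚ :- (:- β :* y :- :- β :* c) :=
                c :* (con 1ℚ :+ w) :+ β :* (y :- :- (:- b :* w :* c))
                  :+ (c :* w) :* (β :* b :- con 1ℚ)
                  :+ :- con 1ℚ :* ((β :+ con 1ℚ) :* c :- con 1ℚ)) refl
              (seq β n) (seq b n) (seq c n) (seq w n) (seq y n)))))
      (0<* {c} {1ℝ + w} 0<c (proj₁ (r^-bounds m))))

  -- A positive exponent drops by one since β r = -1. At exponent 0, where `ℕ.pred` stays put, βc -
  -- 1 = -c.
  orbit-step : ∀ m {y z} → y ≃ - (r ^ m * c) → z ≃ - β * y - fromℤ (orbitDigit m) →
               z ≃ - (r ^ ℕ.pred m * c)
  orbit-step zero {y} {z} y≃ z≃ =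
    modulo {z} { - (r ^ ℕ.pred zero * c)} {z} { - β * y - fromℤ (orbitDigit zero)} 1ℝ z≃
      (modulo {z} { - (r ^ ℕ.pred zero * c) + 1ℝ * (z - (- β * y - fromℤ (orbitDigit zero)))} {y} { - (r ^ zero * c)} (- β) y≃
        (modulo {z} { - (r ^ ℕ.pred zero * c) + 1ℝ * (z - (- β * y - fromℤ (orbitDigit zero))) + - β * (y - - (r ^ zero * c))}
          {(β + 1ℝ) * c} {1ℝ} 1ℝ [β+1]c≃1
          (pointwise λ n → solve 4
            (λ β c y z → z :=
              :- (con 1ℚ :* c) :+ con 1ℚ :* (z :- (:- β :* y :- con 1ℚ))
                :+ :- β :* (y :- :- (con 1ℚ :* c))
                :+ con 1ℚ :* ((β :+ con 1ℚ) :* c :- con 1ℚ)) refl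
            (seq β n) (seq c n) (seq y n) (seq z n))))
  orbit-step (suc m) {y} {z} y≃ z≃ =
    let w = r ^ m
        w′c = - (r ^ ℕ.pred (suc m) * c)
    in modulo {z} {w′c} {z} { - β * y - fromℤ (orbitDigit (suc m))} 1ℝ z≃
      (modulo {z} { w′c + 1ℝ * (z - (- β * y - fromℤ (orbitDigit (suc m))))} {y} { - (r ^ suc m * c)} (- β) y≃
        (modulo {z} { w′c + 1ℝ * (z - (- β * y - fromℤ (orbitDigit (suc m)))) + - β * (y - - (r ^ suc m * c))}
          {β * b} {1ℝ} (- (c * w)) βb≃1
          (pointwise λ n → solve 6
            (λ β b c w y z → z :=
              :- (w :* c) :+ con 1ℚ :* (z :- (:- β :* y :- con 0ℚ))
                :+ :- β :* (y :- :- (:- b :* w :* c))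
                :+ :- (c :* w) :* (β :* b :- con 1ℚ)) refl
            (seq β n) (seq b n) (seq c n) (seq w n) (seq y n) (seq z n))))

  -- Truncated subtraction describes the whole orbit: the exponent falls to 0 in m steps and remains
  -- there.
  T^-orbit : ∀ m i {x y} → x ≃ - (r ^ m * c) → T^ i x y → y ≃ - (r ^ (m ∸ i) * c)
  T^-orbit m zero {x} {y} x≃ x≃y =
    subst (λ k → y ≃ - (r ^ k * c)) {m} {m ∸ zero} refl
      (≃-trans {y} {x} { - (r ^ m * c)} (≃-sym {x} {y} x≃y) x≃)
  T^-orbit m (suc i) {x} {z} x≃ (y , x↦y , _ , j , j-digit , z≃) =
    subst (λ k → z ≃ - (r ^ k * c)) {ℕ.pred (m ∸ i)} {m ∸ suc i} (ℕₚ.pred[m∸n]≡m∸[1+n] m i)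
      (orbit-step (m ∸ i) {y} {z} y≃
        -- The digit j supplied by `T` is only known to be a floor; uniqueness identifies it with
        -- the computed one.
        (subst (λ d → z ≃ - β * y - fromℤ d) {j} {orbitDigit (m ∸ i)}
          (floor-unique (- β * y - ℓ β 1<β) j (orbitDigit (m ∸ i)) j-digit (isOrbitDigit (m ∸ i) {y} y≃)) z≃))
    where
    y≃ : y ≃ - (r ^ (m ∸ i) * c)
    y≃ = T^-orbit m i {x} {y} x≃ x↦y

  -- Failure of Property (-F)

  r^c∈⇒¬Property-F : ∀ m → (r ^ m * c) ∈ℤ[b] → ¬ Property-F
  r^c∈⇒¬Property-F m h F = infinite (F (- (r ^ m * c)) (neg∈ {r ^ m * c} h))
    where
    -- Position m + N lies past both thresholds: the orbit has reached -c, where the digit is 1, and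
    -- the digits of a finite expansion have become 0.
    1≡0 : ∀ N {y d} → T^ (m ℕ.+ N) (scale (- (r ^ m * c)) zero) y → IsDigit y d → d ≡ + 0 → + 1 ≡ + 0
    1≡0 N {y} {d} x↦y d-digit d≡0 =
      trans (cong orbitDigit (sym (ℕₚ.m≤n⇒m∸n≡0 (ℕₚ.m≤m+n m N))))
        (trans
          (floor-unique (- β * y - ℓ β 1<β) (orbitDigit (m ∸ (m ℕ.+ N))) d
            (isOrbitDigit (m ∸ (m ℕ.+ N)) {y}
              (T^-orbit m (m ℕ.+ N) {scale (- (r ^ m * c)) zero} {y} (pointwise λ n → ℚₚ.*-identityʳ (seq (- (r ^ m * c)) n)) x↦y))
            d-digit)
          d≡0)
    infinite : ¬ HasFiniteExpansion (- (r ^ m * c))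
    -- A positive shift is not minimal, since shift 0 already fits.
    infinite (_ , (suc _ , _ , minimal , _) , _) = minimal 0 ℕ.z<s (fits m)
    infinite (_ , (zero , _ , _ , d , digits , refl) , N , vanishes) =
      let (y , x↦y , d-digit) = digits (m ℕ.+ N)
      in contradiction (1≡0 N {y} {d (m ℕ.+ N)} x↦y d-digit (vanishes (m ℕ.+ N) (ℕₚ.m≤n+m N m))) λ ()

theorem1 : (β : ℝ) (1<β : 1ℝ < β) →
    let open NegativeBase β 1<β in
    Σ ℕ (λ k → 1 ≤ℕ k × T^ k ℓ 0ℝ)
    ⊎ Σ ℤ[X] (λ p → evalℝ p β ≃ 0ℝ × ∣ evalℤ p -1ℤ ∣ ≡ 1) →
    ¬ Property-F
theorem1 β 1<β (inj₁ (k , _ , ℓ↦0)) =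
  r^c∈⇒¬Property-F β 1<β 0 (T^ℓ≃0⇒c∈ β 1<β k ℓ↦0)
theorem1 β 1<β (inj₂ (p , p≃0 , ∣e∣≡1)) =
  r^c∈⇒¬Property-F β 1<β (length p) (p[β]≃0⇒c∈ β 1<β p p≃0 ∣e∣≡1)
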